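{- Let $F_n^{(a)}(q)$ ($n\ge 0$) be the $q$-Fibonacci numbers with parameter $a$. For every integer $n\ge 0$ and every $t\ne 0$ such that $(t^{ -1}q^{a+1};q)_n\neq 0$, $$\sum_{k=0}^n \frac{1}{t^k}\cdot \frac{ F^{(a)}_{k+2}(q) - t F^{(a)}_{k}(q)}{(t^{ -1}q^{a+1};q)_{k}}= \frac{1}{t^n}\cdot \frac{F^{(a)}_{n+1}(q)}{(t^{ -1}q^{a+1};q)_{n}}.$$
   Context: The $q$-Fibonacci numbers with parameter $a$ are defined by $F_0^{(a)}(q)=0$, $F_1^{(a)}(q)=1$, and $F_{n+2}^{(a)}(q) = F_{n+1}^{(a)}(q) + q^{a+n} F_n^{(a)}(q)$ for $n\ge 0$. The $q$-rising factorial is $(A;q)_0=1$ and $(A;q)_m=(1-A)(1-Aq)\cdots(1-Aq^{m-1})$ for $m\ge 1$. Here $q$ is a nonzero complex number (or an indeterminate), and $q^{a+m}$ means $q^a\cdot q^m$ for a fixed nonzero value $q^a$. $t$ is an indeterminate or a complex number. -}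

module Defs where

open import Algebra.Apartness.Bundles using (HeytingField; HeytingCommutativeRing)
open import Algebra.Bundles using (CommutativeRing)
import Algebra.Apartness.Properties.HeytingCommutativeRing as HCRProperties
import Algebra.Properties.Semiring.Exp as SemiringExp
import Algebra.Properties.Monoid.Sum as MonoidSum
open import Data.Nat.Base as ℕ using (ℕ; zero; suc; _≤′_; ≤′-refl; ≤′-step)
open import Data.Nat.Properties using (≤⇒≤′)
open import Data.Product.Base using (_,_; proj₁; proj₂)
import Relation.Binary.Reasoning.Setoid as SetoidReasoning

-- The ground field is an arbitrary Heyting field.  This covers ℂ as well as
-- fields of rational functions (q or t an indeterminate).  The hypotheses
-- "≠ 0" are read as "# 0#", which is what makes an element invertible; for a
-- field with decidable equality # may be taken to be ≉.
module QFibonacci {c ℓ₁ ℓ₂} (K : HeytingField c ℓ₁ ℓ₂) where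

  open HeytingField K
  open HCRProperties heytingCommutativeRing

  private
    commutativeRing : CommutativeRing c ℓ₁
    commutativeRing =
      HeytingCommutativeRing.commutativeRing heytingCommutativeRing

    module R = CommutativeRing commutativeRing

  open SemiringExp R.semiring public using (_^_)
  open MonoidSum R.+-monoid public using (sum⁺-syntax)

  infix  8 _⁻¹[_]
  infixl 7 _/_[_]

  -- #⇒invertible inverts x - 0#, which is ≈ x.
  _⁻¹[_] : (x : Carrier) → x # 0# → Carrier
  x ⁻¹[ x#0 ] = proj₁ (#⇒invertible x#0)

  ⁻¹-inverseʳ : ∀ x (x#0 : x # 0#) → x * x ⁻¹[ x#0 ] ≈ 1#
  ⁻¹-inverseʳ x x#0 =
    trans (*-congʳ (sym (x-0≈x x))) (proj₂ (proj₂ (#⇒invertible x#0)))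

  _/_[_] : (x y : Carrier) → y # 0# → Carrier
  x / y [ y#0 ] = x * y ⁻¹[ y#0 ]

  -- F qᵃ q n is the n-th q-Fibonacci number with parameter a.  Here qᵃ stands
  -- for the fixed value q^a, so q^(a+m) is qᵃ * q ^ m.
  F : (qᵃ q : Carrier) → ℕ → Carrier
  F qᵃ q 0             = 0#
  F qᵃ q 1             = 1#
  F qᵃ q (suc (suc n)) = F qᵃ q (suc n) + (qᵃ * q ^ n) * F qᵃ q n

  -- (A ; q)ₘ = (1 - A)(1 - A q) ⋯ (1 - A q^(m-1))
  ⦅_⨾_⦆_ : (A q : Carrier) → ℕ → Carrier
  ⦅ A ⨾ q ⦆ zero  = 1#
  ⦅ A ⨾ q ⦆ suc m = ⦅ A ⨾ q ⦆ m * (1# - A * q ^ m)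

  ^-#0 : ∀ {x} → x # 0# → ∀ n → x ^ n # 0#
  ^-#0 x#0 zero    = 1#0
  ^-#0 x#0 (suc n) = x#0y#0→xy#0 x#0 (^-#0 x#0 n)

  xy#0→x#0 : ∀ {x y} → x * y # 0# → x # 0#
  xy#0→x#0 {x} {y} xy#0 = invertibleʳ⇒# (y * z , (begin
    (x - 0#) * (y * z)  ≈⟨ *-congʳ (x-0≈x x) ⟩
    x * (y * z)         ≈⟨ *-assoc x y z ⟨
    x * y * z           ≈⟨ ⁻¹-inverseʳ (x * y) xy#0 ⟩
    1#                  ∎))
    where
    open SetoidReasoning setoid
    z = (x * y) ⁻¹[ xy#0 ]

  -- (A ; q)ₖ divides (A ; q)ₙ for k ≤ n, so the single hypothesis on (A ; q)ₙ
  -- makes every denominator in the sum invertible.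
  ⦅⦆-#0 : ∀ {A q n k} → k ℕ.≤ n → ⦅ A ⨾ q ⦆ n # 0# → ⦅ A ⨾ q ⦆ k # 0#
  ⦅⦆-#0 {A} {q} k≤n = go (≤⇒≤′ k≤n)
    where
    go : ∀ {n k} → k ≤′ n → ⦅ A ⨾ q ⦆ n # 0# → ⦅ A ⨾ q ⦆ k # 0#
    go ≤′-refl       p = p
    go (≤′-step k≤n) p = go k≤n (xy#0→x#0 p)

{-# OPTIONS --safe #-}

-- Induction on n: adding the next summand to the right-hand side for n gives the
-- right-hand side for n + 1.  Over the common denominator t^(n+1) (A;q)_(n+1),
-- with A = t⁻¹ q^(a+1), the numerators agree because
-- t (1 - A q^n) = t - q^(a+n+1), so that the Fibonacci recurrence gives
-- t (1 - A q^n) F_(n+1) + (F_(n+3) - t F_(n+1)) = F_(n+2).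
module Submission where

open import Defs
open import Algebra.Apartness.Bundles using (HeytingField; HeytingCommutativeRing)
open import Algebra.Bundles using (CommutativeRing)
import Algebra.Properties.CommutativeSemigroup as CommutativeSemigroupProperties
import Algebra.Properties.Monoid as MonoidProperties
import Algebra.Properties.Monoid.Sum as MonoidSum
import Algebra.Properties.Ring as RingProperties
open import Data.Fin.Base using (Fin; toℕ)
open import Data.Fin.Properties using (toℕ≤pred[n]; toℕ-fromℕ; toℕ-inject₁)
open import Data.Nat.Base as ℕ using (ℕ; zero; suc)
open import Data.Vec.Functional using (Vector; init; last)
open import Relation.Binary.PropositionalEquality.Core as ≡ using (_≡_)
import Relation.Binary.Reasoning.Setoid as SetoidReasoning

module FieldProperties {c ℓ₁ ℓ₂} (K : HeytingField c ℓ₁ ℓ₂) where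

  open HeytingField K
  open QFibonacci K
  open SetoidReasoning setoid

  private
    module R = CommutativeRing
      (HeytingCommutativeRing.commutativeRing heytingCommutativeRing)

  open CommutativeSemigroupProperties R.*-commutativeSemigroup
    using (x∙yz≈y∙xz; x∙yz≈yx∙z)
  open MonoidProperties R.*-monoid using (cancelˡ)
  open RingProperties R.ring
    using (//-rightDividesˡ; //-rightDividesʳ; x[y-z]≈xy-xz; [y-z]x≈yx-zx)
  open MonoidSum R.+-monoid using (sum; sum-init-last; sum-cong-≋)

  ⁻¹-unique : ∀ {x y} (x#0 : x # 0#) → x * y ≈ 1# → y ≈ x ⁻¹[ x#0 ]
  ⁻¹-unique {x} {y} x#0 xy≈1 = begin
    y                     ≈⟨ cancelˡ (⁻¹-inverseʳ x x#0) y ⟨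
    x * (x ⁻¹[ x#0 ] * y) ≈⟨ x∙yz≈y∙xz x _ y ⟩
    x ⁻¹[ x#0 ] * (x * y) ≈⟨ *-congˡ xy≈1 ⟩
    x ⁻¹[ x#0 ] * 1#      ≈⟨ *-identityʳ _ ⟩
    x ⁻¹[ x#0 ]           ∎

  -- An inverse is extracted from an apartness proof, so two proofs about the same denominator could
  -- a priori yield different inverses; uniqueness identifies them.
  ⁻¹-irrelevant : ∀ {x} (p p′ : x # 0#) → x ⁻¹[ p ] ≈ x ⁻¹[ p′ ]
  ⁻¹-irrelevant {x} p p′ = ⁻¹-unique p′ (⁻¹-inverseʳ x p)

  -- Recovers an old denominator's inverse from that of the enlarged product. Both sides are needed:
  -- `t ^ suc n` gains its factor on the left, `⦅ A ⨾ q ⦆ (suc n)` on the right.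
  ⁻¹-cancelˡ : ∀ {x y} (xy#0 : x * y # 0#) (y#0 : y # 0#) →
               x * (x * y) ⁻¹[ xy#0 ] ≈ y ⁻¹[ y#0 ]
  ⁻¹-cancelˡ {x} {y} xy#0 y#0 =
    ⁻¹-unique y#0 (trans (x∙yz≈yx∙z y x _) (⁻¹-inverseʳ (x * y) xy#0))

  ⁻¹-cancelʳ : ∀ {x y} (xy#0 : x * y # 0#) (x#0 : x # 0#) →
               y * (x * y) ⁻¹[ xy#0 ] ≈ x ⁻¹[ x#0 ]
  ⁻¹-cancelʳ {x} {y} xy#0 x#0 =
    ⁻¹-unique x#0 (trans (sym (*-assoc x y _)) (⁻¹-inverseʳ (x * y) xy#0))

  -- The products `t * s` and `d * w` have the shape to which `t ^ suc n` and `⦅ A ⨾ q ⦆ (suc n)`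
  -- unfold, so the induction step needs no rewriting of denominators.
  /-common-denominator :
    ∀ {s t d w} (s#0 : s # 0#) (ts#0 : t * s # 0#) (d#0 : d # 0#) (dw#0 : d * w # 0#) x y →
    1# / s [ s#0 ] * (x / d [ d#0 ]) + 1# / t * s [ ts#0 ] * (y / d * w [ dw#0 ])
    ≈ 1# / t * s [ ts#0 ] * ((t * w * x + y) / d * w [ dw#0 ])
  /-common-denominator {s} {t} {d} {w} s#0 ts#0 d#0 dw#0 x y = begin
    1# * s ⁻¹[ s#0 ] * (x * d ⁻¹[ d#0 ]) + 1# * u * (y * v)
      ≈⟨ +-congʳ (*-cong (trans (*-identityˡ _) (sym (⁻¹-cancelˡ ts#0 s#0)))
                         (*-congˡ (sym (⁻¹-cancelʳ dw#0 d#0)))) ⟩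
    t * u * (x * (w * v)) + 1# * u * (y * v)
      ≈⟨ +-congʳ rearrange ⟩
    1# * u * (t * w * x * v) + 1# * u * (y * v)
      ≈⟨ distribˡ _ _ _ ⟨
    1# * u * (t * w * x * v + y * v)
      ≈⟨ *-congˡ (distribʳ v _ y) ⟨
    1# * u * ((t * w * x + y) * v) ∎
    where
    u = (t * s) ⁻¹[ ts#0 ]
    v = (d * w) ⁻¹[ dw#0 ]

    rearrange : t * u * (x * (w * v)) ≈ 1# * u * (t * w * x * v)
    rearrange = begin
      t * u * (x * (w * v))    ≈⟨ *-cong (*-comm t u) (x∙yz≈yx∙z x w v) ⟩
      u * t * (w * x * v)      ≈⟨ *-assoc u t _ ⟩
      u * (t * (w * x * v))    ≈⟨ *-congˡ (*-assoc t _ v) ⟨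
      u * (t * (w * x) * v)    ≈⟨ *-cong (*-identityˡ u) (*-congʳ (*-assoc t w x)) ⟨
      1# * u * (t * w * x * v) ∎

  -- Meant for x = t F_(n+1), y = q^(a+n+1) F_(n+1) and z = F_(n+2), where `z + y` is the unfolded
  -- F_(n+3).
  [x-y]+[[z+y]-x]≈z : ∀ x y z → (x - y) + ((z + y) - x) ≈ z
  [x-y]+[[z+y]-x]≈z x y z = begin
    (x - y) + ((z + y) - x) ≈⟨ +-comm _ _ ⟩
    ((z + y) - x) + (x - y) ≈⟨ +-assoc _ x (- y) ⟨
    ((z + y) - x) + x - y   ≈⟨ +-congʳ (//-rightDividesˡ x (z + y)) ⟩
    (z + y) - y             ≈⟨ //-rightDividesʳ y z ⟩
    z                       ∎

  module _ (q qᵃ t : Carrier) (t#0 : t # 0#) where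

    A : Carrier
    A = t ⁻¹[ t#0 ] * (qᵃ * q)

    -- The factor t cancels the t⁻¹ inside `A`, leaving exactly the coefficient in the recurrence
    -- for F_(n+3).
    t[1-Aqⁿ]≈t-qᵃqⁿ⁺¹ : ∀ n → t * (1# - A * q ^ n) ≈ t - qᵃ * q ^ suc n
    t[1-Aqⁿ]≈t-qᵃqⁿ⁺¹ n = begin
      t * (1# - A * q ^ n)       ≈⟨ x[y-z]≈xy-xz t 1# _ ⟩
      t * 1# - t * (A * q ^ n)   ≈⟨ +-cong (*-identityʳ t) (-‿cong (sym (*-assoc t A _))) ⟩
      t - t * A * q ^ n          ≈⟨ +-congˡ (-‿cong (*-congʳ (cancelˡ (⁻¹-inverseʳ t t#0) _))) ⟩
      t - qᵃ * q * q ^ n         ≈⟨ +-congˡ (-‿cong (*-assoc qᵃ q _)) ⟩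
      t - qᵃ * q ^ suc n         ∎

    F-numerator : ∀ n →
      t * (1# - A * q ^ n) * F qᵃ q (1 ℕ.+ n) + (F qᵃ q (3 ℕ.+ n) - t * F qᵃ q (1 ℕ.+ n))
      ≈ F qᵃ q (2 ℕ.+ n)
    F-numerator n = trans
      (+-congʳ (trans (*-congʳ (t[1-Aqⁿ]≈t-qᵃqⁿ⁺¹ n)) ([y-z]x≈yx-zx _ t _)))
      ([x-y]+[[z+y]-x]≈z _ _ _)

    summand : ∀ k → ⦅ A ⨾ q ⦆ k # 0# → Carrier
    summand k p = 1# / t ^ k [ ^-#0 t#0 k ]
                * ((F qᵃ q (2 ℕ.+ k) - t * F qᵃ q k) / ⦅ A ⨾ q ⦆ k [ p ])

    closedForm : ∀ n → ⦅ A ⨾ q ⦆ n # 0# → Carrier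
    closedForm n p = 1# / t ^ n [ ^-#0 t#0 n ] * (F qᵃ q (1 ℕ.+ n) / ⦅ A ⨾ q ⦆ n [ p ])

    -- Once the indices are unified, the powers of t carry the same apartness proof, and only the
    -- inverses of `⦅ A ⨾ q ⦆ k` can still differ.
    summand-cong : ∀ {j k} → j ≡ k → ∀ p p′ → summand j p ≈ summand k p′
    summand-cong ≡.refl p p′ = *-congˡ (*-congˡ (⁻¹-irrelevant p p′))

    summand-zero : ∀ p p′ → summand 0 p ≈ closedForm 0 p′
    summand-zero p p′ = *-congˡ (*-cong F₂-tF₀≈F₁ (⁻¹-irrelevant p p′))
      where
      F₂-tF₀≈F₁ : 1# + qᵃ * 1# * 0# - t * 0# ≈ 1#
      F₂-tF₀≈F₁ = begin
        -- Both terms containing F_0 vanish; exchanging one zero for the other lets them cancel.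
        1# + qᵃ * 1# * 0# - t * 0#       ≈⟨ +-congˡ (-‿cong (trans (zeroʳ t) (sym (zeroʳ _)))) ⟩
        1# + qᵃ * 1# * 0# - qᵃ * 1# * 0# ≈⟨ //-rightDividesʳ _ 1# ⟩
        1#                               ∎

    closedForm-suc : ∀ n p p′ → closedForm n p + summand (suc n) p′ ≈ closedForm (suc n) p′
    closedForm-suc n p p′ = trans
      (/-common-denominator (^-#0 t#0 n) (^-#0 t#0 (suc n)) p p′ _ _)
      (*-congˡ (*-congʳ (F-numerator n)))

    summands : ∀ n → ⦅ A ⨾ q ⦆ n # 0# → Vector Carrier (suc n)
    summands n p k = summand (toℕ k) (⦅⦆-#0 (toℕ≤pred[n] k) p)

    -- Two mismatches are bridged: the index is `toℕ (inject₁ k)` instead of `toℕ k`, and the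
    -- apartness proofs descend from level n + 1 instead of n.
    init-summands : ∀ n p (k : Fin (suc n)) →
      init (summands (suc n) p) k ≈ summands n (xy#0→x#0 p) k
    init-summands n p k = summand-cong (toℕ-inject₁ k) _ _

    sum-summands : ∀ n p → sum (summands n p) ≈ closedForm n p
    -- A sum over a single index unfolds to its term plus `0#`.
    sum-summands zero    p = trans (+-identityʳ _) (summand-zero _ p)
    sum-summands (suc n) p = begin
      sum (summands (suc n) p)
        -- `sum` unfolds from the first term, whereas the induction has to split off the last.
        ≈⟨ sum-init-last (summands (suc n) p) ⟩
      sum (init (summands (suc n) p)) + last (summands (suc n) p)
        ≈⟨ +-cong (sum-cong-≋ (init-summands n p)) (summand-cong (toℕ-fromℕ (suc n)) _ p) ⟩
      sum (summands n (xy#0→x#0 p)) + summand (suc n) p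
        ≈⟨ +-congʳ (sum-summands n (xy#0→x#0 p)) ⟩
      closedForm n (xy#0→x#0 p) + summand (suc n) p
        ≈⟨ closedForm-suc n (xy#0→x#0 p) p ⟩
      closedForm (suc n) p ∎

mainTheorem13 : ∀ {c ℓ₁ ℓ₂} (K : HeytingField c ℓ₁ ℓ₂) →
    let open HeytingField K
        open QFibonacci K
    in
    (q qᵃ : Carrier) → q # 0# → qᵃ # 0# →
    (n : ℕ) (t : Carrier) (t#0 : t # 0#) →
    let A = t ⁻¹[ t#0 ] * (qᵃ * q) in
    (A⨾q#0 : ⦅ A ⨾ q ⦆ n # 0#) →
    ∑[ k ≤ n ]
      ( 1# / t ^ toℕ k [ ^-#0 t#0 (toℕ k) ]
      * ( (F qᵃ q (2 ℕ.+ toℕ k) - t * F qᵃ q (toℕ k))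
          / ⦅ A ⨾ q ⦆ toℕ k [ ⦅⦆-#0 (toℕ≤pred[n] k) A⨾q#0 ] ) )
    ≈ 1# / t ^ n [ ^-#0 t#0 n ] * (F qᵃ q (1 ℕ.+ n) / ⦅ A ⨾ q ⦆ n [ A⨾q#0 ])
mainTheorem13 K q qᵃ _ _ n t t#0 A⨾q#0 = FieldProperties.sum-summands K q qᵃ t t#0 n A⨾q#0
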